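{- Let $S$ be a finite subset of $\mathbf{Z}^2$, viewed as a set of unit squares in the plane, and put $B=\{(i,j)\in S\mid i\equiv j\pmod 2\}$ (the black squares of $S$) and $W=S\setminus B$ (the white squares of $S$). Define $$E=\{b\in B\mid b-(0,1)\notin W\},\quad I=\{b\in B\mid b-(0,1)\in W\},\quad X=\{b\in\mathbf{Z}^2\setminus B\mid b-(0,1)\in W\}.$$ Then there is a bijection between the set of domino tilings of $S$ and the set of families of paths, using steps chosen from $\{(1,1),(0,2),(-1,1)\}$, such that each entry in $E$ is connected by some path to an exit in $X$ and vice versa, with paths passing through elements of $I$ only (that is, each path of the family starts at an element of $E$, ends at an element of $X$, and all its intermediate points are in $I$; every element of $E$ is the start of a path and every element of $X$ is the end of a path), and such that each element lies on at most one path.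
   Context: A domino tiling of $S$ is a partition of $S$ into two-element subsets $\{s,t\}$ of adjacent squares, i.e. with $s-t\in\{\pm(1,0),\pm(0,1)\}$. A path is a finite sequence of points of $\mathbf{Z}^2$ in which each difference of consecutive points is one of the allowed steps. The second coordinate is the horizontal one, so $b-(0,1)$ is the square immediately to the left of $b$; elements of $E$ ("entries"), $I$ ("interior edges") and $X$ ("exits") represent vertical edges with a white-coloured square to their left and a black-coloured square to their right, each edge being identified with the square to its right. -}

module Defs where

open import Data.Integer using (ℤ; 0ℤ; 1ℤ; -1ℤ; +_; _-_)
open import Data.Integer.Divisibility using (_∣_)
open import Data.List using (List; []; _∷_; _∷ʳ_)
import Data.List.Membership.Setoid as SetoidMembership
open import Data.List.Membership.Propositional using (_∈_)
import Data.List.Relation.Binary.Subset.Setoid as SetoidSubset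
open import Data.List.Relation.Binary.Subset.Propositional using (_⊆_)
open import Data.List.Relation.Unary.All using (All)
open import Data.List.Relation.Unary.Linked using (Linked)
open import Data.Product using (Σ-syntax; ∃-syntax; _×_; _,_; proj₁)
open import Level using (Level; 0ℓ; _⊔_)
open import Relation.Binary.Bundles using (Setoid)
import Relation.Binary.Construct.Interior.Symmetric as Interior
import Relation.Binary.Construct.On as On
open import Relation.Binary.PropositionalEquality using (_≡_; setoid)
open import Relation.Nullary using (¬_)

private
  variable
    a ℓ : Level

-- Finite subsets of a setoid: lists, where order and multiplicity are ignored
-- by the equality (mutual inclusion).
FiniteSubsets : Setoid a ℓ → Setoid a (a ⊔ ℓ)
FiniteSubsets A = record
  { Carrier       = List (Setoid.Carrier A)
  ; _≈_           = Interior.SymInterior _⊑_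
  ; isEquivalence = Interior.isEquivalence
                      {R = _⊑_}
                      (λ x∈xs → x∈xs)
                      (λ xs⊑ys ys⊑zs x∈xs → ys⊑zs (xs⊑ys x∈xs))
  }
  where open SetoidSubset A renaming (_⊆_ to _⊑_)

Square : Set
Square = ℤ × ℤ

infixl 6 _⊖_

_⊖_ : Square → Square → Square
(i , j) ⊖ (k , l) = (i - k , j - l)

left : Square → Square
left b = b ⊖ (0ℤ , 1ℤ)

Adjacent : Square → Square → Set
Adjacent s t =
  s ⊖ t ∈ (1ℤ , 0ℤ) ∷ (-1ℤ , 0ℤ) ∷ (0ℤ , 1ℤ) ∷ (0ℤ , -1ℤ) ∷ []

Step : Square → Square → Set
Step s t = t ⊖ s ∈ (1ℤ , 1ℤ) ∷ (0ℤ , + 2) ∷ (-1ℤ , 1ℤ) ∷ []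

SquareSets : Setoid 0ℓ 0ℓ
SquareSets = FiniteSubsets (setoid Square)

open Setoid SquareSets public using () renaming (_≈_ to _≐_)
open SetoidMembership SquareSets public using () renaming (_∈_ to _∈ˢ_)

module _ (S : List Square) where

  B W E I X : Square → Set
  B (i , j) = (i , j) ∈ S × + 2 ∣ i - j
  W s       = s ∈ S × ¬ B s
  E b       = B b × ¬ W (left b)
  I b       = B b × W (left b)
  X b       = ¬ B b × W (left b)

  -- Blocks are compared by _≐_, not as lists.
  record IsDominoTiling (T : List (List Square)) : Set where
    field
      domino   : ∀ {D} → D ∈ˢ T → ∃[ s ] ∃[ t ] Adjacent s t × D ≐ (s ∷ t ∷ [])
      within   : ∀ {D} → D ∈ˢ T → D ⊆ S
      covering : ∀ {s} → s ∈ S → ∃[ D ] D ∈ˢ T × s ∈ D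
      disjoint : ∀ {D D′ s} → D ∈ˢ T → D′ ∈ˢ T → s ∈ D → s ∈ D′ → D ≐ D′

  DominoTilings : Setoid 0ℓ 0ℓ
  DominoTilings = On.setoid {B = Σ[ T ∈ List (List Square) ] IsDominoTiling T}
                    (FiniteSubsets SquareSets) proj₁

  -- E and X are disjoint, so there is no one-point path from E to X and the
  -- two endpoints can be displayed separately.
  Connects : Square → Square → List Square → Set
  Connects e x p =
    Linked Step p × E e × X x × ∃[ ms ] All I ms × p ≡ e ∷ (ms ∷ʳ x)

  record IsPathFamily (F : List (List Square)) : Set where
    field
      path     : ∀ {p} → p ∈ F → ∃[ e ] ∃[ x ] Connects e x p
      entry    : ∀ {e} → E e → ∃[ p ] ∃[ x ] p ∈ F × Connects e x p
      exit     : ∀ {x} → X x → ∃[ p ] ∃[ e ] p ∈ F × Connects e x p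
      disjoint : ∀ {p q s} → p ∈ F → q ∈ F → s ∈ p → s ∈ q → p ≡ q

  -- Families are sets of paths, and a path is a sequence.  Restricting to
  -- finite sets loses nothing: the paths start at distinct elements of E.
  PathFamilies : Setoid 0ℓ 0ℓ
  PathFamilies = On.setoid {B = Σ[ F ∈ List (List Square) ] IsPathFamily F}
                   (FiniteSubsets (setoid (List Square))) proj₁

{-# OPTIONS --safe #-}
module Submission where

-- A domino tiling is a perfect matching b ↦ mate b of the black squares with
-- the white ones, along adjacencies.  Put next b = mate b + (0,1).  Then next is
-- a bijection from B = E ∪ I onto the squares to the right of white ones, I ∪ X,
-- and for each black b either next b = b (b is matched with the square to its
-- left) or next b − b is one of the three steps.  Steps strictly increase the
-- column, so the non-trivial orbits of next are exactly disjoint paths from E to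
-- X through I.  Conversely a path family determines next: it follows the paths
-- and fixes the black squares on none of them.

open import Defs
open import Data.Integer using (ℤ; 0ℤ; 1ℤ; +_; -[1+_]; ∣_∣; _+_; _-_; -_; _<_; _≤_; +<+; +≤+; -≤+)
open import Data.Integer.Divisibility using (_∣_)
open import Data.Integer.Divisibility.Signed using (∣ᵤ⇒∣; ∣⇒∣ᵤ; ∣m∣n⇒∣m-n)
import Data.Integer.Properties as ℤ
open import Data.Integer.Tactic.RingSolver using (solve-∀)
open import Data.List using (List; []; _∷_; _∷ʳ_; filter; map)
open import Data.List.Membership.Propositional using (_∈_; find; lose)
open import Data.List.Membership.Propositional.Properties using (∈-filter⁺; ∈-filter⁻; ∈-map⁺; ∈-map⁻)
open import Data.List.Membership.Setoid.Properties using (∈-resp-≈)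
open import Data.List.Relation.Unary.All using (All; []; _∷_)
open import Data.List.Relation.Unary.Any using (here; there; any?)
import Data.List.Relation.Unary.Any.Properties as Any
open import Data.List.Relation.Unary.Linked using (Linked; [-]; _∷_)
open import Data.Nat using (zero; suc)
import Data.Nat as ℕ
import Data.Nat.Divisibility as ℕ
import Data.Nat.Properties as ℕ
open import Data.Product using (∃-syntax; _×_; _,_; proj₁; proj₂; map₂)
open import Data.Product.Properties using (≡-dec; ,-injectiveˡ; ,-injectiveʳ)
open import Data.Sum using (_⊎_; inj₁; inj₂; [_,_]′)
open import Function using (_∘_)
open import Function.Bundles using (Bijection; Inverse)
import Function.Construct.Composition as Composition
open import Function.Properties.Inverse using (Inverse⇒Bijection)
open import Induction.WellFounded using (Acc; acc; WellFounded)
open import Level using (0ℓ)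
open import Relation.Binary.Bundles using (Setoid)
open import Relation.Binary.Construct.Interior.Symmetric using (_,_; lhs≤rhs; rhs≤lhs)
open import Relation.Binary.Definitions using (DecidableEquality)
open import Relation.Binary.PropositionalEquality using (_≡_; _≢_; refl; sym; trans; cong; cong₂; subst)
open import Relation.Nullary using (¬_; Dec; yes; no; contradiction)
open import Relation.Nullary.Decidable using (¬?; _×-dec_; map′; from-no)

open Setoid SquareSets using () renaming (refl to ≐-refl; sym to ≐-sym; trans to ≐-trans)

-- Inverses between setoids.

module _ (A B : Setoid 0ℓ 0ℓ) where
  open Setoid A using () renaming (Carrier to A₀; _≈_ to _≈₁_)
  open Setoid B using () renaming (Carrier to B₀; _≈_ to _≈₂_)

  -- The laws of `Inverse` concern points merely equal to an image; given congruence they follow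
  -- from the two round trips. The congruences take their points explicitly because the equalities
  -- of these setoids unfold and no longer determine them.
  strictInverse : (to : A₀ → B₀) (from : B₀ → A₀) →
                  (∀ x y → x ≈₁ y → to x ≈₂ to y) → (∀ x y → x ≈₂ y → from x ≈₁ from y) →
                  (∀ y → to (from y) ≈₂ y) → (∀ x → from (to x) ≈₁ x) → Inverse A B
  strictInverse to from to-cong from-cong to-from from-to = record
    { to        = to
    ; from      = from
    ; to-cong   = to-cong _ _
    ; from-cong = from-cong _ _
    ; inverse   = (λ x≈ → Setoid.trans B (to-cong _ _ x≈) (to-from _))
                , (λ y≈ → Setoid.trans A (from-cong _ _ y≈) (from-to _))
    }

-- Differences of squares, adjacency and steps.

col : Square → ℤ
col = proj₂

right : Square → Square
right (i , j) = (i , j + 1ℤ)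

infix 4 _≟_

_≟_ : DecidableEquality Square
_≟_ = ≡-dec ℤ._≟_ ℤ._≟_

open import Data.List.Membership.DecPropositional _≟_ using (_∈?_)

left-right : ∀ s → left (right s) ≡ s
left-right (i , j) = cong₂ _,_ (e₁ i) (e₂ j)
  where
  e₁ : ∀ i → i - 0ℤ ≡ i
  e₁ = solve-∀
  e₂ : ∀ j → (j + 1ℤ) - 1ℤ ≡ j
  e₂ = solve-∀

right-left : ∀ s → right (left s) ≡ s
right-left (i , j) = cong₂ _,_ (e₁ i) (e₂ j)
  where
  e₁ : ∀ i → i - 0ℤ ≡ i
  e₁ = solve-∀
  e₂ : ∀ j → (j - 1ℤ) + 1ℤ ≡ j
  e₂ = solve-∀

left-injective : ∀ s t → left s ≡ left t → s ≡ t
left-injective s t eq = trans (sym (right-left s)) (trans (cong right eq) (right-left t))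

right-injective : ∀ s t → right s ≡ right t → s ≡ t
right-injective s t eq = trans (sym (left-right s)) (trans (cong left eq) (left-right t))

⊖-swap : ∀ s t → t ⊖ s ≡ (0ℤ , 0ℤ) ⊖ (s ⊖ t)
⊖-swap (i , j) (k , l) = cong₂ _,_ (e i k) (e j l)
  where
  e : ∀ i k → k - i ≡ 0ℤ - (i - k)
  e = solve-∀

right-⊖ : ∀ s t → right t ⊖ s ≡ (0ℤ , 1ℤ) ⊖ (s ⊖ t)
right-⊖ (i , j) (k , l) = cong₂ _,_ (e₁ i k) (e₂ j l)
  where
  e₁ : ∀ i k → k - i ≡ 0ℤ - (i - k)
  e₁ = solve-∀
  e₂ : ∀ j l → (l + 1ℤ) - j ≡ 1ℤ - (j - l)
  e₂ = solve-∀

⊖-left : ∀ s t → s ⊖ left t ≡ (0ℤ , 1ℤ) ⊖ (t ⊖ s)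
⊖-left (i , j) (k , l) = cong₂ _,_ (e₁ i k) (e₂ j l)
  where
  e₁ : ∀ i k → i - (k - 0ℤ) ≡ 0ℤ - (k - i)
  e₁ = solve-∀
  e₂ : ∀ j l → j - (l - 1ℤ) ≡ 1ℤ - (l - j)
  e₂ = solve-∀

⊖-self : ∀ s → s ⊖ s ≡ (0ℤ , 0ℤ)
⊖-self (i , j) = cong₂ _,_ (ℤ.+-inverseʳ i) (ℤ.+-inverseʳ j)

⊖≡0⇒≡ : ∀ s t → s ⊖ t ≡ (0ℤ , 0ℤ) → s ≡ t
⊖≡0⇒≡ (i , j) (k , l) eq =
  cong₂ _,_ (ℤ.i-j≡0⇒i≡j i k (,-injectiveˡ eq)) (ℤ.i-j≡0⇒i≡j j l (,-injectiveʳ eq))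

Adjacent-sym : ∀ s t → Adjacent s t → Adjacent t s
Adjacent-sym s t = go
  where
  flip : ∀ {d} → s ⊖ t ≡ d → t ⊖ s ≡ (0ℤ , 0ℤ) ⊖ d
  flip eq = trans (⊖-swap s t) (cong ((0ℤ , 0ℤ) ⊖_) eq)
  go : Adjacent s t → Adjacent t s
  go (here eq)                         = there (here (flip eq))
  go (there (here eq))                 = here (flip eq)
  go (there (there (here eq)))         = there (there (there (here (flip eq))))
  go (there (there (there (here eq)))) = there (there (here (flip eq)))

-- The map d ↦ (0,1) - d sends the four adjacency vectors to the three steps and zero; zero arises
-- when `t` is just left of `s`, the case excluded by hypothesis.
Adjacent⇒Step : ∀ s t → Adjacent s t → right t ≢ s → Step s (right t)
Adjacent⇒Step s t adj t′≢s = go adj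
  where
  shift : ∀ {d} → s ⊖ t ≡ d → right t ⊖ s ≡ (0ℤ , 1ℤ) ⊖ d
  shift eq = trans (right-⊖ s t) (cong ((0ℤ , 1ℤ) ⊖_) eq)
  go : Adjacent s t → Step s (right t)
  go (here eq)                         = there (there (here (shift eq)))
  go (there (here eq))                 = here (shift eq)
  go (there (there (here eq)))         = contradiction (⊖≡0⇒≡ (right t) s (shift eq)) t′≢s
  go (there (there (there (here eq)))) = there (here (shift eq))

-- The map d ↦ (0,1) - d is an involution, so it carries the steps back to adjacency vectors.
Step⇒Adjacent : ∀ s t → Step s t → Adjacent s (left t)
Step⇒Adjacent s t = go
  where
  shift : ∀ {d} → t ⊖ s ≡ d → s ⊖ left t ≡ (0ℤ , 1ℤ) ⊖ d
  shift eq = trans (⊖-left s t) (cong ((0ℤ , 1ℤ) ⊖_) eq)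
  go : Step s t → Adjacent s (left t)
  go (here eq)                 = there (here (shift eq))
  go (there (here eq))         = there (there (there (here (shift eq))))
  go (there (there (here eq))) = here (shift eq)

Adjacent-left : ∀ s → Adjacent s (left s)
Adjacent-left s = there (there (here (trans (⊖-left s s) (cong ((0ℤ , 1ℤ) ⊖_) (⊖-self s)))))

Step⇒col< : ∀ s t → Step s t → col s < col t
Step⇒col< (i , j) (k , l) = go
  where
  e : ∀ j l → l ≡ j + (l - j)
  e = solve-∀
  ascend : ∀ n → l - j ≡ + suc n → j < l
  ascend n eq = subst (j <_) (trans (cong (_+_ j) (sym eq)) (sym (e j l)))
    (subst (_< j + + suc n) (ℤ.+-identityʳ j) (ℤ.+-monoʳ-< j (+<+ (ℕ.s≤s ℕ.z≤n))))
  go : Step (i , j) (k , l) → j < l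
  -- The argument of `ascend` is one less than the column component of the step.
  go (here eq)                 = ascend 0 (,-injectiveʳ eq)
  go (there (here eq))         = ascend 1 (,-injectiveʳ eq)
  go (there (there (here eq))) = ascend 0 (,-injectiveʳ eq)

-- Parity and adjacency.

Even : Square → Set
Even (i , j) = + 2 ∣ i - j

even? : ∀ s → Dec (Even s)
even? (i , j) = 2 ℕ.∣? ∣ i - j ∣

2∣n⊎2∣1+n : ∀ n → 2 ℕ.∣ n ⊎ 2 ℕ.∣ suc n
2∣n⊎2∣1+n zero = inj₁ (2 ℕ.∣0)
2∣n⊎2∣1+n (suc n) with 2∣n⊎2∣1+n n
... | inj₁ 2∣n   = inj₂ (ℕ.∣m∣n⇒∣m+n ℕ.∣-refl 2∣n)
... | inj₂ 2∣1+n = inj₁ 2∣1+n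

-- Handles two odd numbers: adding 1 to both makes them even and keeps their difference.
¬2∣d⇒2∣d+1 : ∀ d → ¬ + 2 ∣ d → + 2 ∣ d + 1ℤ
¬2∣d⇒2∣d+1 (+ n) odd with 2∣n⊎2∣1+n n
... | inj₁ even = contradiction even odd
... | inj₂ even = subst (2 ℕ.∣_) (ℕ.+-comm 1 n) even
¬2∣d⇒2∣d+1 -[1+ n ] odd with 2∣n⊎2∣1+n n
... | inj₁ even = subst (2 ℕ.∣_) (sym (∣-[1+n]+1∣ n)) even
  where
  ∣-[1+n]+1∣ : ∀ n → ∣ -[1+ n ] + 1ℤ ∣ ≡ n
  ∣-[1+n]+1∣ zero    = refl
  ∣-[1+n]+1∣ (suc n) = refl
... | inj₂ even = contradiction even odd

2∣difference : ∀ d e → + 2 ∣ d → + 2 ∣ e → + 2 ∣ d - e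
2∣difference d e 2∣d 2∣e = ∣⇒∣ᵤ (∣m∣n⇒∣m-n {+ 2} {d} {e} (∣ᵤ⇒∣ 2∣d) (∣ᵤ⇒∣ 2∣e))

difference-odd : ∀ s t → Adjacent s t → ¬ Even (s ⊖ t)
-- In each case the coordinates of the difference differ by ±1, so `Even` asks whether 2 divides 1.
difference-odd _ _ (here eq)                         = subst (¬_ ∘ Even) (sym eq) (from-no (2 ℕ.∣? 1))
difference-odd _ _ (there (here eq))                 = subst (¬_ ∘ Even) (sym eq) (from-no (2 ℕ.∣? 1))
difference-odd _ _ (there (there (here eq)))         = subst (¬_ ∘ Even) (sym eq) (from-no (2 ℕ.∣? 1))
difference-odd _ _ (there (there (there (here eq)))) = subst (¬_ ∘ Even) (sym eq) (from-no (2 ℕ.∣? 1))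

-- Across an adjacency i − j changes by ±1.
Adjacent⇒parity : ∀ s t → Adjacent s t → Even s × ¬ Even t ⊎ ¬ Even s × Even t
Adjacent⇒parity s@(i , j) t@(k , l) adj with even? s | even? t
... | yes es | no ¬et = inj₁ (es , ¬et)
... | no ¬es | yes et = inj₂ (¬es , et)
... | yes es | yes et =
  contradiction (subst (+ 2 ∣_) (e i j k l) (2∣difference (i - j) (k - l) es et)) (difference-odd s t adj)
  where
  e : ∀ i j k l → (i - j) - (k - l) ≡ (i - k) - (j - l)
  e = solve-∀
... | no ¬es | no ¬et =
  contradiction (subst (+ 2 ∣_) (e i j k l)
                  (2∣difference ((i - j) + 1ℤ) ((k - l) + 1ℤ)
                    (¬2∣d⇒2∣d+1 (i - j) ¬es) (¬2∣d⇒2∣d+1 (k - l) ¬et)))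
                (difference-odd s t adj)
  where
  e : ∀ i j k l → ((i - j) + 1ℤ) - ((k - l) + 1ℤ) ≡ (i - k) - (j - l)
  e = solve-∀

-- Two-element blocks.

[x,y]≐[y,x] : ∀ {x y : Square} → (x ∷ y ∷ []) ≐ (y ∷ x ∷ [])
[x,y]≐[y,x] = swap , swap
  where
  swap : ∀ {x y z : Square} → z ∈ x ∷ y ∷ [] → z ∈ y ∷ x ∷ []
  swap (here eq)         = there (here eq)
  swap (there (here eq)) = here eq

[x,y]≐[x,z]⇒y≡z : ∀ {x y z : Square} → (x ∷ y ∷ []) ≐ (x ∷ z ∷ []) → y ≡ z
[x,y]≐[x,z]⇒y≡z eq with lhs≤rhs eq (there (here refl))
... | there (here y≡z) = y≡z
-- If y = x, the block is {x}, and z is forced onto x as well.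
... | here y≡x with rhs≤lhs eq (there (here refl))
...   | here z≡x         = trans y≡x (sym z≡x)
...   | there (here z≡y) = sym z≡y

-- Colours of squares.

module _ (S : List Square) where

  B? : ∀ s → Dec (B S s)
  B? s = (s ∈? S) ×-dec even? s

  W? : ∀ s → Dec (W S s)
  W? s = (s ∈? S) ×-dec ¬? (B? s)

  E? : ∀ s → Dec (E S s)
  E? s = B? s ×-dec ¬? (W? (left s))

module _ {S : List Square} where

  B⊎W : ∀ {s} → s ∈ S → B S s ⊎ W S s
  B⊎W {s} s∈S with B? S s
  ... | yes b  = inj₁ b
  ... | no  ¬b = inj₂ (s∈S , ¬b)

  E⊎I : ∀ {b} → B S b → E S b ⊎ I S b
  E⊎I {b} Bb with W? S (left b)
  ... | yes w  = inj₂ (Bb , w)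
  ... | no  ¬w = inj₁ (Bb , ¬w)

  B⊎X : ∀ {c} → W S (left c) → B S c ⊎ X S c
  B⊎X {c} w with B? S c
  ... | yes b  = inj₁ b
  ... | no  ¬b = inj₂ (¬b , w)

  Adjacent⇒colours : ∀ {s t} → s ∈ S → t ∈ S → Adjacent s t → B S s × W S t ⊎ W S s × B S t
  Adjacent⇒colours {s} {t} s∈S t∈S adj with Adjacent⇒parity s t adj
  ... | inj₁ (es , ¬et) = inj₁ ((s∈S , es) , (t∈S , ¬et ∘ proj₂))
  ... | inj₂ (¬es , et) = inj₂ ((s∈S , ¬es ∘ proj₂) , (t∈S , et))

-- Matchings of black with white squares.

module _ (S : List Square) where

  -- Only the values of mate on B matter.
  record Matching : Set where
    field
      mate       : Square → Square
      white      : ∀ {b} → B S b → W S (mate b)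
      adjacent   : ∀ {b} → B S b → Adjacent b (mate b)
      injective  : ∀ {b b′} → B S b → B S b′ → mate b ≡ mate b′ → b ≡ b′
      surjective : ∀ {w} → W S w → ∃[ b ] B S b × mate b ≡ w

  Matchings : Setoid 0ℓ 0ℓ
  Matchings = record
    { Carrier       = Matching
    ; _≈_           = λ M N → ∀ {b} → B S b → Matching.mate M b ≡ Matching.mate N b
    ; isEquivalence = record
      { refl  = λ _ → refl
      ; sym   = λ M≈N Bb → sym (M≈N Bb)
      ; trans = λ L≈M M≈N Bb → trans (L≈M Bb) (M≈N Bb)
      }
    }

-- Tilings and matchings

module _ {S : List Square} {T : List (List Square)} (isTiling : IsDominoTiling S T) where
  open IsDominoTiling isTiling

  partner : ∀ {s} → s ∈ S → ∃[ t ] Adjacent s t × (s ∷ t ∷ []) ∈ˢ T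
  partner {s} s∈S with covering s∈S
  ... | D , D∈T , s∈D with domino D∈T
  ... | u , v , u~v , D≐uv with lhs≤rhs D≐uv s∈D
  -- Blocks count only up to `≐`, so the domino may be rewritten with `s` in front.
  ... | here refl         = v , u~v , ∈-resp-≈ SquareSets D≐uv D∈T
  ... | there (here refl) = u , Adjacent-sym u v u~v
                          , ∈-resp-≈ SquareSets (≐-trans D≐uv [x,y]≐[y,x]) D∈T

  -- Both blocks contain `s`, so disjointness makes them the same set.
  partner-unique : ∀ {s t t′} → (s ∷ t ∷ []) ∈ˢ T → (s ∷ t′ ∷ []) ∈ˢ T → t ≡ t′
  partner-unique st∈T st′∈T =
    [x,y]≐[x,z]⇒y≡z (disjoint st∈T st′∈T (here refl) (here refl))

  tilingMate : Square → Square
  tilingMate s with s ∈? S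
  ... | yes s∈S = proj₁ (partner s∈S)
  -- A default value outside `S`.
  ... | no  _   = s

  tilingMate-spec : ∀ {s} → s ∈ S → Adjacent s (tilingMate s) × (s ∷ tilingMate s ∷ []) ∈ˢ T
  tilingMate-spec {s} s∈S with s ∈? S
  ... | yes s∈S = proj₂ (partner s∈S)
  ... | no  s∉S = contradiction s∈S s∉S

  tilingMate-white : ∀ {b} → B S b → W S (tilingMate b)
  tilingMate-white {b} Bb with tilingMate-spec (proj₁ Bb)
  ... | adj , bm∈T with Adjacent⇒colours (proj₁ Bb) (within bm∈T (there (here refl))) adj
  ... | inj₁ (_ , Wm)  = Wm
  ... | inj₂ (Wb , _)  = contradiction Bb (proj₂ Wb)

  tilingMate-surjective : ∀ {w} → W S w → ∃[ b ] B S b × tilingMate b ≡ w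
  tilingMate-surjective {w} Ww with partner (proj₁ Ww)
  ... | b , adj , wb∈T with Adjacent⇒colours (proj₁ Ww) (within wb∈T (there (here refl))) adj
  ... | inj₁ (Bw , _) = contradiction Bw (proj₂ Ww)
  ... | inj₂ (_ , Bb) = b , Bb , partner-unique (proj₂ (tilingMate-spec (proj₁ Bb)))
                                                (∈-resp-≈ SquareSets [x,y]≐[y,x] wb∈T)

  tiling⇒matching : Matching S
  tiling⇒matching = record
    { mate       = tilingMate
    ; white      = tilingMate-white
    ; adjacent   = λ Bb → proj₁ (tilingMate-spec (proj₁ Bb))
    -- Reversed, the dominoes of `b` and `b′` both begin with the common mate, so their other ends
    -- agree.
    ; injective  = λ {b} {b′} Bb Bb′ eq → partner-unique
        (∈-resp-≈ SquareSets [x,y]≐[y,x] (proj₂ (tilingMate-spec (proj₁ Bb))))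
        (∈-resp-≈ SquareSets [x,y]≐[y,x]
          (subst (λ w → (b′ ∷ w ∷ []) ∈ˢ T) (sym eq) (proj₂ (tilingMate-spec (proj₁ Bb′)))))
    ; surjective = tilingMate-surjective
    }

  -- The ends of a domino have opposite colours, so its black end and the mate of that end describe
  -- it. Hence no block is lost when the tiling is rebuilt from its matching.
  ∈ˢ⇒black-domino : ∀ {D} → D ∈ˢ T → ∃[ b ] B S b × D ≐ (b ∷ tilingMate b ∷ [])
  ∈ˢ⇒black-domino {D} D∈T with domino D∈T
  ... | s , t , s~t , D≐st
    with Adjacent⇒colours (within D∈T (rhs≤lhs D≐st (here refl)))
                          (within D∈T (rhs≤lhs D≐st (there (here refl)))) s~t
  ... | inj₁ (Bs , _) = s , Bs , subst (λ w → D ≐ (s ∷ w ∷ []))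
          (partner-unique (∈-resp-≈ SquareSets D≐st D∈T) (proj₂ (tilingMate-spec (proj₁ Bs)))) D≐st
  ... | inj₂ (_ , Bt) = t , Bt , subst (λ w → D ≐ (t ∷ w ∷ []))
          (partner-unique (∈-resp-≈ SquareSets D≐ts D∈T) (proj₂ (tilingMate-spec (proj₁ Bt)))) D≐ts
    where
    D≐ts : D ≐ (t ∷ s ∷ [])
    D≐ts = ≐-trans D≐st [x,y]≐[y,x]

module _ {S : List Square} (M : Matching S) where
  open Matching M

  blackDomino : Square → List Square
  blackDomino b = b ∷ mate b ∷ []

  matchingTiles : List (List Square)
  matchingTiles = map blackDomino (filter (B? S) S)

  ∈ˢ-matchingTiles⁺ : ∀ {D b} → B S b → D ≐ blackDomino b → D ∈ˢ matchingTiles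
  ∈ˢ-matchingTiles⁺ Bb D≐ = Any.map⁺ (lose (∈-filter⁺ (B? S) (proj₁ Bb) Bb) D≐)

  ∈ˢ-matchingTiles⁻ : ∀ {D} → D ∈ˢ matchingTiles → ∃[ b ] B S b × D ≐ blackDomino b
  ∈ˢ-matchingTiles⁻ D∈ with find (Any.map⁻ D∈)
  ... | b , b∈ , D≐ = b , proj₂ (∈-filter⁻ (B? S) {xs = S} b∈) , D≐

  blackDomino-disjoint : ∀ {b b′ s} → B S b → B S b′ → s ∈ blackDomino b → s ∈ blackDomino b′ → b ≡ b′
  blackDomino-disjoint Bb Bb′ (here refl)         (here eq)           = eq
  -- In the mixed cases one square would be both black and, as a mate, white.
  blackDomino-disjoint Bb Bb′ (here refl)         (there (here refl)) = contradiction Bb (proj₂ (white Bb′))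
  blackDomino-disjoint Bb Bb′ (there (here refl)) (here refl)         = contradiction Bb′ (proj₂ (white Bb))
  blackDomino-disjoint Bb Bb′ (there (here refl)) (there (here eq))   = injective Bb Bb′ eq

  matching⇒tiling : IsDominoTiling S matchingTiles
  matching⇒tiling = record
    { domino   = λ D∈T → let b , Bb , D≐ = ∈ˢ-matchingTiles⁻ D∈T in b , mate b , adjacent Bb , D≐
    ; within   = within
    ; covering = covering
    ; disjoint = disjoint
    }
    where
    within : ∀ {D} → D ∈ˢ matchingTiles → ∀ {s} → s ∈ D → s ∈ S
    within D∈T s∈D with ∈ˢ-matchingTiles⁻ D∈T
    ... | b , Bb , D≐ with lhs≤rhs D≐ s∈D
    ... | here refl         = proj₁ Bb
    ... | there (here refl) = proj₁ (white Bb)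
    covering : ∀ {s} → s ∈ S → ∃[ D ] D ∈ˢ matchingTiles × s ∈ D
    covering {s} s∈S with B⊎W s∈S
    ... | inj₁ Bs = blackDomino s , ∈ˢ-matchingTiles⁺ Bs ≐-refl , here refl
    ... | inj₂ Ws with surjective Ws
    ... | b , Bb , refl = blackDomino b , ∈ˢ-matchingTiles⁺ Bb ≐-refl , there (here refl)
    disjoint : ∀ {D D′ s} → D ∈ˢ matchingTiles → D′ ∈ˢ matchingTiles → s ∈ D → s ∈ D′ → D ≐ D′
    disjoint D∈T D′∈T s∈D s∈D′ with ∈ˢ-matchingTiles⁻ D∈T | ∈ˢ-matchingTiles⁻ D′∈T
    ... | b , Bb , D≐ | b′ , Bb′ , D′≐
      with blackDomino-disjoint Bb Bb′ (lhs≤rhs D≐ s∈D) (lhs≤rhs D′≐ s∈D′)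
    ... | refl = ≐-trans D≐ (≐-sym D′≐)

tilings≅matchings : ∀ S → Inverse (DominoTilings S) (Matchings S)
tilings≅matchings S = strictInverse (DominoTilings S) (Matchings S)
  (λ (_ , isT) → tiling⇒matching isT) (λ M → matchingTiles M , matching⇒tiling M)
  to-cong from-cong to-from from-to
  where
  open Setoid (DominoTilings S) using () renaming (Carrier to Tiling; _≈_ to _≈₁_)
  open Setoid (Matchings S) using () renaming (_≈_ to _≈₂_)

  to-cong : ∀ (T T′ : Tiling) → T ≈₁ T′ → tiling⇒matching (proj₂ T) ≈₂ tiling⇒matching (proj₂ T′)
  to-cong (_ , isT) (_ , isT′) T≈T′ Bb = partner-unique isT′
    (lhs≤rhs T≈T′ (proj₂ (tilingMate-spec isT (proj₁ Bb)))) (proj₂ (tilingMate-spec isT′ (proj₁ Bb)))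

  from-⊑ : ∀ M N → M ≈₂ N → ∀ {D} → D ∈ˢ matchingTiles M → D ∈ˢ matchingTiles N
  from-⊑ M N M≈N {D} D∈ with ∈ˢ-matchingTiles⁻ M D∈
  ... | b , Bb , D≐ = ∈ˢ-matchingTiles⁺ N Bb (subst (λ w → D ≐ (b ∷ w ∷ [])) (M≈N Bb) D≐)

  from-cong : ∀ M N → M ≈₂ N → (matchingTiles M , matching⇒tiling M) ≈₁ (matchingTiles N , matching⇒tiling N)
  from-cong M N M≈N = from-⊑ M N M≈N , from-⊑ N M (λ Bb → sym (M≈N Bb))

  to-from : ∀ M → tiling⇒matching (matching⇒tiling M) ≈₂ M
  to-from M Bb = partner-unique isT (proj₂ (tilingMate-spec isT (proj₁ Bb))) (∈ˢ-matchingTiles⁺ M Bb ≐-refl)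
    where isT = matching⇒tiling M

  from-to : ∀ (T : Tiling) → (_ , matching⇒tiling (tiling⇒matching (proj₂ T))) ≈₁ T
  from-to (T , isT) = ⊑ , ⊒
    where
    M = tiling⇒matching isT
    ⊑ : ∀ {D} → D ∈ˢ matchingTiles M → D ∈ˢ T
    ⊑ D∈ with ∈ˢ-matchingTiles⁻ M D∈
    ... | b , Bb , D≐ = ∈-resp-≈ SquareSets (≐-sym D≐) (proj₂ (tilingMate-spec isT (proj₁ Bb)))
    ⊒ : ∀ {D} → D ∈ˢ T → D ∈ˢ matchingTiles M
    ⊒ D∈ with ∈ˢ⇒black-domino isT D∈
    ... | b , Bb , D≐ = ∈ˢ-matchingTiles⁺ M Bb D≐

-- Paths and trails

data Consecutive (b c : Square) : List Square → Set where
  first : ∀ {p} → Consecutive b c (b ∷ c ∷ p)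
  later : ∀ {a p} → Consecutive b c p → Consecutive b c (a ∷ p)

Consecutive⇒∈ˡ : ∀ {b c p} → Consecutive b c p → b ∈ p
Consecutive⇒∈ˡ first     = here refl
Consecutive⇒∈ˡ (later n) = there (Consecutive⇒∈ˡ n)

Consecutive⇒∈ʳ : ∀ {b c p} → Consecutive b c p → c ∈ p
Consecutive⇒∈ʳ first     = there (here refl)
Consecutive⇒∈ʳ (later n) = there (Consecutive⇒∈ʳ n)

predecessor : ∀ {a s p} → s ∈ p → ∃[ b ] Consecutive b s (a ∷ p)
predecessor (here refl) = _ , first
predecessor (there s∈p) = map₂ later (predecessor s∈p)

successor? : ∀ b p → Dec (∃[ c ] Consecutive b c p)
successor? b []          = no λ ()
successor? b (a ∷ [])    = no λ { (_ , later ()) }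
successor? b (a ∷ c ∷ p) with b ≟ a | successor? b (c ∷ p)
... | yes refl | _           = yes (c , first)
... | no  _    | yes (d , n) = yes (d , later n)
... | no  b≢a  | no ¬n       = no λ { (_ , first) → b≢a refl ; (d , later n) → ¬n (d , n) }

module _ (S : List Square) where

  -- A trail from b to x along R visits the squares b ∷ p.
  data Trail (R : Square → Square → Set) : Square → List Square → Square → Set where
    stop : ∀ {x} → X S x → Trail R x [] x
    go   : ∀ {b c p x} → B S b → W S (left c) → R b c → Trail R c p x → Trail R b (c ∷ p) x

module _ {S : List Square} where

  -- Passes between `Step`, for paths, and `Next`, for orbits of a matching. The consecutive pair is
  -- handed to `f` because a step obeys the matching of a family only where some path of the family
  -- takes it.
  mapTrail : ∀ {R R′ a p x} → (∀ {b c} → Consecutive b c (a ∷ p) → B S b → R b c → R′ b c) →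
             Trail S R a p x → Trail S R′ a p x
  mapTrail f (stop Xx)      = stop Xx
  mapTrail f (go Bb Wc r t) = go Bb Wc (f first Bb r) (mapTrail (f ∘ later) t)

  trail-consecutive : ∀ {R a p x b c} → Trail S R a p x → Consecutive b c (a ∷ p) →
                      B S b × W S (left c) × R b c
  trail-consecutive (go Bb Wc r t) first     = Bb , Wc , r
  trail-consecutive (go Bb Wc r t) (later n) = trail-consecutive t n
  trail-consecutive (stop _)       (later ())

  -- Only the last square of a trail lacks a successor, and it is an exit, hence not black.
  trail-successor : ∀ {R a p x s} → Trail S R a p x → s ∈ a ∷ p → B S s → ∃[ c ] Consecutive s c (a ∷ p)
  trail-successor (stop Xx)      (here refl) Bs = contradiction Bs (proj₁ Xx)
  trail-successor (go _ _ _ t)   (here refl) Bs = _ , first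
  trail-successor (go _ _ _ t)   (there s∈p) Bs = map₂ later (trail-successor t s∈p Bs)

  -- Entries and interior squares are black, interior squares and exits have a white left neighbour,
  -- so each step fits `go`. The membership `x ∈ q` later yields the predecessor of an exit.
  connects⇒trail : ∀ {e x p} → Connects S e x p → ∃[ q ] x ∈ q × p ≡ e ∷ q × Trail S Step e q x
  connects⇒trail {x = x} (linked , Ee , Xx , ms , Ims , refl) =
    ms ∷ʳ x , Any.++⁺ʳ ms (here refl) , refl , trail (proj₁ Ee) ms Ims linked
    where
    trail : ∀ {b} → B S b → ∀ ms → All (I S) ms → Linked Step (b ∷ (ms ∷ʳ x)) →
            Trail S Step b (ms ∷ʳ x) x
    trail Bb []       []         (r ∷ _)  = go Bb (proj₂ Xx) r (stop Xx)
    trail Bb (m ∷ ms) (Im ∷ Ims) (r ∷ rs) = go Bb (proj₂ Im) r (trail (proj₁ Im) ms Ims rs)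

  trail⇒connects : ∀ {e q x} → E S e → Trail S Step e q x → Connects S e x (e ∷ q)
  trail⇒connects {e} {q} {x} Ee t = linked t , Ee , end t , interior (proj₁ Ee) t
    where
    linked : ∀ {b p} → Trail S Step b p x → Linked Step (b ∷ p)
    linked (stop _)      = [-]
    linked (go _ _ r t)  = r ∷ linked t
    end : ∀ {b p} → Trail S Step b p x → X S x
    end (stop Xx)    = Xx
    end (go _ _ _ t) = end t
    interior : ∀ {b p} → B S b → Trail S Step b p x → ∃[ ms ] All (I S) ms × b ∷ p ≡ b ∷ (ms ∷ʳ x)
    interior Bb (stop Xx) = contradiction Bb (proj₁ Xx)
    interior Bb (go _ _ _ (stop _)) = [] , [] , refl
    -- The middle square is interior: white on its left as a target, black as the source of the next
    -- step.
    interior {b} Bb (go _ Wc _ t@(go Bc _ _ _)) with interior Bc t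
    ... | ms , Ims , eq = _ ∷ ms , (Bc , Wc) ∷ Ims , cong (b ∷_) eq

  col≤ : ∀ {a p x s} → Trail S Step a p x → s ∈ a ∷ p → col a ≤ col s
  col≤ t                      (here refl) = ℤ.≤-refl
  col≤ (go {b} {c} _ _ r t)   (there s∈p) = ℤ.≤-trans (ℤ.<⇒≤ (Step⇒col< b c r)) (col≤ t s∈p)

  col< : ∀ {a p x b c} → Trail S Step a p x → Consecutive b c (a ∷ p) → col a < col c
  col< {b = b} {c} t n =
    ℤ.≤-<-trans (col≤ t (Consecutive⇒∈ˡ n)) (Step⇒col< b c (proj₂ (proj₂ (trail-consecutive t n))))

  -- Columns increase strictly, so the first square of a trail never recurs.
  successor-unique : ∀ {a p x b c c′} → Trail S Step a p x →
                     Consecutive b c (a ∷ p) → Consecutive b c′ (a ∷ p) → c ≡ c′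
  successor-unique t first first = refl
  successor-unique (go {b} {c} _ _ r t) first (later n) =
    contradiction (Step⇒col< b c r) (ℤ.≤⇒≯ (col≤ t (Consecutive⇒∈ˡ n)))
  successor-unique (go {b} {c} _ _ r t) (later n) first =
    contradiction (Step⇒col< b c r) (ℤ.≤⇒≯ (col≤ t (Consecutive⇒∈ˡ n)))
  successor-unique (go _ _ _ t) (later n) (later n′) = successor-unique t n n′
  successor-unique (stop _) (later ()) _

  -- Every square after the head of a trail lies strictly to its right, so the second square of a
  -- path is never entered again.
  predecessor-unique : ∀ {a p x b b′ c} → Trail S Step a p x →
                       Consecutive b c (a ∷ p) → Consecutive b′ c (a ∷ p) → b ≡ b′
  predecessor-unique t first first = refl
  predecessor-unique (go _ _ _ t) first (later n) = contradiction (col< t n) (ℤ.<-irrefl refl)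
  predecessor-unique (go _ _ _ t) (later n) first = contradiction (col< t n) (ℤ.<-irrefl refl)
  predecessor-unique (go _ _ _ t) (later n) (later n′) = predecessor-unique t n n′
  predecessor-unique (stop _) (later ()) _

-- Path families to matchings

module _ {S : List Square} {F : List (List Square)} (isFamily : IsPathFamily S F) where
  open IsPathFamily isFamily

  Follows : Square → Square → Set
  Follows b c = ∃[ p ] p ∈ F × Consecutive b c p

  followed? : ∀ b → Dec (∃[ c ] Follows b c)
  followed? b = map′ (λ any → let p , p∈F , c , n = find {P = λ p → ∃[ c ] Consecutive b c p} any in c , p , p∈F , n)
                     (λ (c , p , p∈F , n) → lose p∈F (c , n))
                     (any? (successor? b) F)

  follows-properties : ∀ {b c} → Follows b c → B S b × W S (left c) × Step b c
  follows-properties (p , p∈F , n) with path p∈F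
  ... | e , x , con with connects⇒trail con
  ... | q , _ , refl , t = trail-consecutive t n

  -- Disjointness puts both pairs on one path, where successors are unique.
  follows-functional : ∀ {b c c′} → Follows b c → Follows b c′ → c ≡ c′
  follows-functional (p , p∈F , n) (p′ , p′∈F , n′)
    with disjoint p∈F p′∈F (Consecutive⇒∈ˡ n) (Consecutive⇒∈ˡ n′) | path p∈F
  ... | refl | e , x , con with connects⇒trail con
  ... | q , _ , refl , t = successor-unique t n n′

  follows-injective : ∀ {b b′ c} → Follows b c → Follows b′ c → b ≡ b′
  follows-injective (p , p∈F , n) (p′ , p′∈F , n′)
    with disjoint p∈F p′∈F (Consecutive⇒∈ʳ n) (Consecutive⇒∈ʳ n′) | path p∈F
  ... | refl | e , x , con with connects⇒trail con
  ... | q , _ , refl , t = predecessor-unique t n n′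

  on-path⇒followed : ∀ {p b} → p ∈ F → b ∈ p → B S b → ∃[ c ] Follows b c
  on-path⇒followed p∈F b∈p Bb with path p∈F
  ... | e , x , con with connects⇒trail con
  ... | q , _ , refl , t with trail-successor t b∈p Bb
  ... | c , n = c , _ , p∈F , n

  entry-followed : ∀ {b} → E S b → ∃[ c ] Follows b c
  entry-followed Eb with entry Eb
  ... | p , x , p∈F , (_ , _ , _ , _ , _ , refl) = on-path⇒followed p∈F (here refl) (proj₁ Eb)

  -- A path square with a white left neighbour is not the entry, so the path has a square before it.
  followed⇒follows : ∀ {b c} → W S (left b) → Follows b c → ∃[ a ] Follows a b
  followed⇒follows Wb (p , p∈F , n) with path p∈F
  ... | e , x , (_ , Ee , _ , _ , _ , refl) with Consecutive⇒∈ˡ n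
  ... | here refl = contradiction Wb (proj₂ Ee)
  ... | there b∈q = map₂ (λ m → p , p∈F , m) (predecessor b∈q)

  -- A black square off every path is matched with the square to its left.
  familyNext : Square → Square
  familyNext b with followed? b
  ... | yes (c , _) = c
  ... | no  _       = b

  familyNext-follows : ∀ {b c} → Follows b c → familyNext b ≡ c
  familyNext-follows {b} b→c with followed? b
  ... | yes (c′ , b→c′) = follows-functional b→c′ b→c
  ... | no  ¬b→         = contradiction (_ , b→c) ¬b→

  familyNext-white : ∀ {b} → B S b → W S (left (familyNext b))
  familyNext-white {b} Bb with followed? b
  ... | yes (c , b→c) = proj₁ (proj₂ (follows-properties b→c))
  -- Entries are always followed, so a fixed black square is interior.
  ... | no  ¬b→ with E⊎I Bb
  ...   | inj₁ Eb = contradiction (entry-followed Eb) ¬b→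
  ...   | inj₂ Ib = proj₂ Ib

  familyNext-adjacent : ∀ b → Adjacent b (left (familyNext b))
  familyNext-adjacent b with followed? b
  ... | yes (c , b→c) = Step⇒Adjacent b c (proj₂ (proj₂ (follows-properties b→c)))
  ... | no  _         = Adjacent-left b

  familyNext-injective : ∀ {b b′} → B S b → B S b′ → familyNext b ≡ familyNext b′ → b ≡ b′
  familyNext-injective {b} {b′} Bb Bb′ eq with followed? b | followed? b′
  ... | yes (c , b→c) | yes (c′ , b′→c′) = follows-injective b→c (subst (Follows b′) (sym eq) b′→c′)
  -- The fixed square would be the successor of the other, hence a black square on a path, hence
  -- followed.
  ... | yes (c , p , p∈F , n) | no ¬b′→ =
          contradiction (on-path⇒followed p∈F (subst (_∈ p) eq (Consecutive⇒∈ʳ n)) Bb′) ¬b′→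
  ... | no ¬b→ | yes (c′ , p , p∈F , n) =
          contradiction (on-path⇒followed p∈F (subst (_∈ p) (sym eq) (Consecutive⇒∈ʳ n)) Bb) ¬b→
  ... | no _ | no _ = eq

  -- An exit and a followed square come from their predecessors on a path; any other square comes
  -- from itself.
  familyNext-surjective : ∀ c → W S (left c) → ∃[ b ] B S b × familyNext b ≡ c
  familyNext-surjective c Wc with B⊎X {c = c} Wc
  ... | inj₂ Xc with exit Xc
  ...   | p , e , p∈F , con with connects⇒trail con
  ...   | q , c∈q , refl , t with predecessor c∈q
  ...   | b , n = b , proj₁ (trail-consecutive t n) , familyNext-follows (_ , p∈F , n)
  familyNext-surjective c Wc | inj₁ Bc with followed? c in eq
  ... | yes (d , c→d) with followed⇒follows {c} Wc c→d
  ...   | b , b→c = b , proj₁ (follows-properties b→c) , familyNext-follows b→c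
  familyNext-surjective c Wc | inj₁ Bc | no ¬c→ = c , Bc , familyNext-unfollowed
    where
    familyNext-unfollowed : familyNext c ≡ c
    familyNext-unfollowed rewrite eq = refl

  family⇒matching : Matching S
  family⇒matching = record
    { mate       = left ∘ familyNext
    ; white      = familyNext-white
    ; adjacent   = λ {b} _ → familyNext-adjacent b
    ; injective  = λ Bb Bb′ eq → familyNext-injective Bb Bb′ (left-injective _ _ eq)
    ; surjective = λ {w} Ww →
        let b , Bb , eq = familyNext-surjective (right w) (subst (W S) (sym (left-right w)) Ww)
        in b , Bb , trans (cong left eq) (left-right w)
    }

-- Matchings to path families

module _ (S : List Square) (f : Square → ℤ) where

  -- Taken with `col` to follow a matching rightwards and with its negative to trace it leftwards.
  Above : Square → Square → Set
  Above d c = d ∈ S × f c < f d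

  upper-bound : ∀ j (xs : List Square) → ∃[ k ] (∀ {s} → s ∈ xs → f s < j + + k)
  upper-bound j []       = 0 , λ ()
  upper-bound j (x ∷ xs) with upper-bound j xs
  -- The first summand reaches beyond `x`, the second beyond the remaining squares.
  ... | k , xs< = suc ∣ f x - j ∣ ℕ.+ k , λ
    { (here refl)  → ℤ.<-≤-trans x< (ℤ.+-monoʳ-≤ j (+≤+ (ℕ.m≤m+n _ k)))
    ; (there s∈xs) → ℤ.<-≤-trans (xs< s∈xs) (ℤ.+-monoʳ-≤ j (+≤+ (ℕ.m≤n+m k _)))
    }
    where
    i≤∣i∣ : ∀ i → i ≤ + ∣ i ∣
    i≤∣i∣ (+ n)    = ℤ.≤-refl
    i≤∣i∣ -[1+ n ] = -≤+
    e : ∀ i j → j + (i - j) ≡ i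
    e = solve-∀
    x< : f x < j + + suc ∣ f x - j ∣
    x< = subst (_< j + + suc ∣ f x - j ∣) (e (f x) j)
           (ℤ.+-monoʳ-< j (ℤ.≤-<-trans (i≤∣i∣ (f x - j)) (+<+ (ℕ.n<1+n _))))

  -- Induction on the gap `k` up to a bound for `S`: each climb uses up at least one unit, and a gap
  -- of zero leaves no room.
  accessible : ∀ k c → (∀ {s} → s ∈ S → f s < f c + + k) → Acc Above c
  accessible zero c S< = acc λ (d∈S , c<d) →
    contradiction (ℤ.<-trans c<d (subst (_ <_) (ℤ.+-identityʳ (f c)) (S< d∈S))) (ℤ.<-irrefl refl)
  accessible (suc k) c S< = acc λ {d} (d∈S , c<d) → accessible k d λ s∈S →
    ℤ.<-≤-trans (S< s∈S) (subst (_≤ f d + + k) (e (f c) (+ k)) (ℤ.+-monoˡ-≤ (+ k) (ℤ.i<j⇒suc[i]≤j c<d)))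
    where
    e : ∀ i k → (1ℤ + i) + k ≡ i + (1ℤ + k)
    e = solve-∀

  Above-wellFounded : WellFounded Above
  Above-wellFounded c = let k , S< = upper-bound (f c) S in accessible k c S<

-- Orbits of a matching.

module _ {S : List Square} (M : Matching S) where
  open Matching M

  next : Square → Square
  next = right ∘ mate

  -- Fixed points, the squares matched to their left, are cut out so that `Next` implies `Step` on
  -- black squares.
  Next : Square → Square → Set
  Next b c = next b ≡ c × c ≢ b

  Next⇒Step : ∀ {b c} → B S b → Next b c → Step b c
  Next⇒Step {b} Bb (refl , moves) = Adjacent⇒Step b (mate b) (adjacent Bb) moves

  next-white : ∀ {b} → B S b → W S (left (next b))
  next-white {b} Bb = subst (W S) (sym (left-right (mate b))) (white Bb)

  next-injective : ∀ {b b′} → B S b → B S b′ → next b ≡ next b′ → b ≡ b′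
  next-injective Bb Bb′ eq = injective Bb Bb′ (right-injective _ _ eq)

  next-surjective : ∀ c → W S (left c) → ∃[ b ] B S b × next b ≡ c
  next-surjective c Wc with surjective Wc
  ... | b , Bb , eq = b , Bb , trans (cong right eq) (right-left c)

  -- An entry fixed by `next` would be matched with its left neighbour, which would then be white.
  entry-moves : ∀ {e} → E S e → next e ≢ e
  entry-moves Ee eq = proj₂ Ee (subst (W S ∘ left) eq (next-white (proj₁ Ee)))

  -- The orbit moves right, and each new square is either black, hence in `S`, or an exit.
  forward : ∀ {b} → Acc (Above S col) b → B S b → next b ≢ b → ∃[ p ] ∃[ x ] Trail S Next b p x
  forward {b} (acc rec) Bb moves with B⊎X {c = next b} (next-white Bb)
  ... | inj₂ Xc = _ , _ , go Bb (next-white Bb) (refl , moves) (stop Xc)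
  ... | inj₁ Bc with forward (rec (proj₁ Bc , Step⇒col< b (next b) (Next⇒Step Bb (refl , moves)))) Bc
                             -- Were `next b` fixed, injectivity would make `b` fixed too.
                             (λ eq → moves (next-injective Bc Bb eq))
  ...   | p , x , t = _ , _ , go Bb (next-white Bb) (refl , moves) t

  -- Preimages under `next` are prepended, moving left within `S`, until an entry appears. The
  -- movement condition is restricted to black `c` so that an exit can be the starting point.
  backward : ∀ {c p x} → Acc (Above S (-_ ∘ col)) c → E S c ⊎ W S (left c) → (B S c → next c ≢ c) →
             Trail S Next c p x →
             ∃[ e ] ∃[ q ] E S e × Trail S Next e q x × (∀ {s} → s ∈ c ∷ p → s ∈ e ∷ q)
  backward _ (inj₁ Ec) _ t = _ , _ , Ec , t , λ s∈ → s∈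
  backward {c} (acc rec) (inj₂ Wc) moves t with next-surjective c Wc
  ... | b , Bb , refl
    with backward (rec (proj₁ Bb , ℤ.neg-mono-< (Step⇒col< b c (Next⇒Step Bb (refl , c≢b)))))
                  (map-I (E⊎I Bb)) (λ _ → c≢b) (go Bb Wc (refl , c≢b) t)
    where
    c≢b : next b ≢ b
    -- If `next` fixed `b`, then `c` would be that same black square, also fixed.
    c≢b eq = moves (subst (B S) (sym eq) Bb) (cong next eq)
    map-I : E S b ⊎ I S b → E S b ⊎ W S (left b)
    map-I = [ inj₁ , inj₂ ∘ proj₂ ]′
  ... | e , q , Ee , t′ , sub = e , q , Ee , t′ , sub ∘ there

  -- `next` dictates every step, and whether the current square is black dictates when to stop.
  trail-functional : ∀ {c p q x y} → Trail S Next c p x → Trail S Next c q y → p ≡ q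
  trail-functional (stop _)  (stop _)       = refl
  trail-functional (stop Xc) (go Bc _ _ _)  = contradiction Bc (proj₁ Xc)
  trail-functional (go Bc _ _ _) (stop Xc)  = contradiction Bc (proj₁ Xc)
  trail-functional (go _ _ (refl , _) t) (go _ _ (refl , _) t′) = cong (_ ∷_) (trail-functional t t′)

  pathFrom : Square → List Square
  pathFrom e with E? S e
  ... | yes Ee = e ∷ proj₁ (forward (Above-wellFounded S col e) (proj₁ Ee) (entry-moves Ee))
  -- A default value off `E`; `matchingPaths` filters such squares away.
  ... | no  _  = []

  pathFrom-trail : ∀ {e} → E S e → ∃[ q ] ∃[ x ] pathFrom e ≡ e ∷ q × Trail S Next e q x
  pathFrom-trail {e} Ee with E? S e
  ... | yes Ee = let q , x , t = forward (Above-wellFounded S col e) (proj₁ Ee) (entry-moves Ee)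
                 in q , x , refl , t
  ... | no ¬Ee = contradiction Ee ¬Ee

  matchingPaths : List (List Square)
  matchingPaths = map pathFrom (filter (E? S) S)

  ∈-matchingPaths⁻ : ∀ {p} → p ∈ matchingPaths →
                     ∃[ e ] ∃[ q ] ∃[ x ] E S e × p ≡ e ∷ q × Trail S Next e q x
  ∈-matchingPaths⁻ p∈ with ∈-map⁻ pathFrom p∈
  ... | e , e∈ , refl with proj₂ (∈-filter⁻ (E? S) {xs = S} e∈)
  ... | Ee with pathFrom-trail Ee
  ... | q , x , eq , t = e , q , x , Ee , eq , t

  ∈-matchingPaths⁺ : ∀ {e q x} → E S e → Trail S Next e q x → e ∷ q ∈ matchingPaths
  ∈-matchingPaths⁺ {e} Ee t with pathFrom-trail Ee
  ... | q′ , x′ , eq , t′ = subst (_∈ matchingPaths)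
          (trans eq (cong (e ∷_) (trail-functional t′ t)))
          (∈-map⁺ pathFrom (∈-filter⁺ (E? S) (proj₁ (proj₁ Ee)) Ee))

  -- The forward orbit of `e`, built so that its last step can be peeled off.
  data Reach (e : Square) : Square → Set where
    start : Reach e e
    step  : ∀ {b} → Reach e b → B S b → Reach e (next b)

  reach : ∀ {e c p x s} → Reach e c → Trail S Next c p x → s ∈ c ∷ p → Reach e s
  reach r t                        (here refl) = r
  reach r (go Bb _ (refl , _) t)   (there s∈p) = reach (step r Bb) t s∈p

  -- Injectivity lets two meeting orbits be walked back together. Neither outlasts the other, since
  -- values of `next` have a white left neighbour and entries do not. The explicit equation avoids
  -- unifying values of `next`.
  reach-unique : ∀ {e e′ s s′} → E S e → E S e′ → Reach e s → Reach e′ s′ → s ≡ s′ → e ≡ e′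
  reach-unique Ee Ee′ start start eq = eq
  reach-unique Ee Ee′ start (step r Bb) refl = contradiction (next-white Bb) (proj₂ Ee)
  reach-unique Ee Ee′ (step r Bb) start refl = contradiction (next-white Bb) (proj₂ Ee′)
  reach-unique Ee Ee′ (step r Bb) (step r′ Bb′) eq = reach-unique Ee Ee′ r r′ (next-injective Bb Bb′ eq)

  trail⇒path : ∀ {e q x} → E S e → Trail S Next e q x → Connects S e x (e ∷ q)
  trail⇒path Ee t = trail⇒connects Ee (mapTrail (λ _ → Next⇒Step) t)

  matching⇒family : IsPathFamily S matchingPaths
  matching⇒family = record
    { path     = path
    ; entry    = entry
    ; exit     = exit
    ; disjoint = disjoint
    }
    where
    path : ∀ {p} → p ∈ matchingPaths → ∃[ e ] ∃[ x ] Connects S e x p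
    path p∈ with ∈-matchingPaths⁻ p∈
    ... | e , q , x , Ee , refl , t = e , x , trail⇒path Ee t
    entry : ∀ {e} → E S e → ∃[ p ] ∃[ x ] p ∈ matchingPaths × Connects S e x p
    entry Ee with pathFrom-trail Ee
    ... | q , x , _ , t = _ , x , ∈-matchingPaths⁺ Ee t , trail⇒path Ee t
    exit : ∀ {x} → X S x → ∃[ p ] ∃[ e ] p ∈ matchingPaths × Connects S e x p
    -- The one-square trail at `x` is extended backwards; its movement condition is vacuous as `x`
    -- is not black.
    exit {x} Xx with backward (Above-wellFounded S (-_ ∘ col) x) (inj₂ (proj₂ Xx))
                              (λ Bx → contradiction Bx (proj₁ Xx)) (stop Xx)
    ... | e , q , Ee , t , _ = e ∷ q , e , ∈-matchingPaths⁺ Ee t , trail⇒path Ee t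
    disjoint : ∀ {p p′ s} → p ∈ matchingPaths → p′ ∈ matchingPaths → s ∈ p → s ∈ p′ → p ≡ p′
    disjoint p∈ p′∈ s∈p s∈p′ with ∈-matchingPaths⁻ p∈ | ∈-matchingPaths⁻ p′∈
    ... | e , q , x , Ee , refl , t | e′ , q′ , x′ , Ee′ , refl , t′
      with reach-unique Ee Ee′ (reach start t s∈p) (reach start t′ s∈p′) refl
    ... | refl = cong (e ∷_) (trail-functional t t′)

  -- The orbit is continued to an exit and then back to an entry. So a black square off all paths is
  -- fixed by `next`, as `familyNext` prescribes.
  moving-on-path : ∀ {b} → B S b → next b ≢ b → ∃[ p ] p ∈ matchingPaths × b ∈ p
  moving-on-path {b} Bb moves with forward (Above-wellFounded S col b) Bb moves
  ... | p , x , t with backward (Above-wellFounded S (-_ ∘ col) b)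
                                ([ inj₁ , inj₂ ∘ proj₂ ]′ (E⊎I Bb)) (λ _ → moves) t
  ... | e , q , Ee , t′ , sub = e ∷ q , ∈-matchingPaths⁺ Ee t′ , sub (here refl)

-- The correspondence of matchings and path families.

matchings≅families : ∀ S → Inverse (Matchings S) (PathFamilies S)
matchings≅families S = strictInverse (Matchings S) (PathFamilies S)
  (λ M → matchingPaths M , matching⇒family M) (λ (_ , isF) → family⇒matching isF)
  to-cong from-cong to-from from-to
  where
  open Setoid (Matchings S) using () renaming (_≈_ to _≈₁_)
  open Setoid (PathFamilies S) using () renaming (Carrier to Family; _≈_ to _≈₂_)

  to-⊑ : ∀ M N → M ≈₁ N → ∀ {p} → p ∈ matchingPaths M → p ∈ matchingPaths N
  to-⊑ M N M≈N p∈ with ∈-matchingPaths⁻ M p∈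
  ... | e , q , x , Ee , refl , t = ∈-matchingPaths⁺ N Ee
          (mapTrail (λ _ Bb (eq , moves) → trans (cong right (sym (M≈N Bb))) eq , moves) t)

  to-cong : ∀ M N → M ≈₁ N → (matchingPaths M , matching⇒family M) ≈₂ (matchingPaths N , matching⇒family N)
  to-cong M N M≈N = to-⊑ M N M≈N , to-⊑ N M (λ Bb → sym (M≈N Bb))

  from-cong : ∀ (F G : Family) → F ≈₂ G → family⇒matching (proj₂ F) ≈₁ family⇒matching (proj₂ G)
  from-cong (F , isF) (G , isG) F≈G {b} Bb = cong left familyNext-≡
    where
    familyNext-≡ : familyNext isF b ≡ familyNext isG b
    familyNext-≡ with followed? isF b | followed? isG b
    ... | yes (c , p , p∈F , n) | yes (c′ , b→c′) = follows-functional isG (p , lhs≤rhs F≈G p∈F , n) b→c′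
    ... | yes (c , p , p∈F , n) | no ¬b→ = contradiction (c , p , lhs≤rhs F≈G p∈F , n) ¬b→
    ... | no ¬b→ | yes (c , p , p∈G , n) = contradiction (c , p , rhs≤lhs F≈G p∈G , n) ¬b→
    ... | no _ | no _ = refl

  to-from : ∀ (F : Family) → (_ , matching⇒family (family⇒matching (proj₂ F))) ≈₂ F
  to-from (F , isF) = ⊑ , ⊒
    where
    open IsPathFamily isF
    M = family⇒matching isF
    next-trail : ∀ {e q x} → e ∷ q ∈ F → Trail S Step e q x → Trail S (Next M) e q x
    next-trail {e} {q} p∈F = mapTrail λ {b} {c} n _ r →
      trans (right-left (familyNext isF b)) (familyNext-follows isF (e ∷ q , p∈F , n)) ,
      -- A step raises the column, so it never ends where it began.
      λ { refl → ℤ.<-irrefl refl (Step⇒col< b c r) }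
    ⊑ : ∀ {p} → p ∈ matchingPaths M → p ∈ F
    ⊑ p∈ with ∈-matchingPaths⁻ M p∈
    ... | e , q , x , Ee , refl , t with entry Ee
    -- The path of `F` from the same entry obeys the same `next`, so the two trails coincide.
    ... | p , x′ , p∈F , con with connects⇒trail con
    ... | q′ , _ , refl , t′ =
      subst (λ q → e ∷ q ∈ F) (trail-functional M (next-trail p∈F t′) t) p∈F
    ⊒ : ∀ {p} → p ∈ F → p ∈ matchingPaths M
    ⊒ p∈F with path p∈F
    ... | e , x , con@(_ , Ee , _) with connects⇒trail con
    ... | q , _ , refl , t = ∈-matchingPaths⁺ M Ee (next-trail p∈F t)

  from-to : ∀ M → family⇒matching (matching⇒family M) ≈₁ M
  from-to M {b} Bb = trans (cong left familyNext-≡) (left-right (Matching.mate M b))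
    where
    isF = matching⇒family M
    familyNext-≡ : familyNext isF b ≡ next M b
    familyNext-≡ with followed? isF b
    ... | yes (c , p , p∈ , n) with ∈-matchingPaths⁻ M p∈
    ...   | e , q , x , Ee , refl , t = sym (proj₁ (proj₂ (proj₂ (trail-consecutive t n))))
    familyNext-≡ | no ¬b→ with next M b ≟ b
    ... | yes eq    = sym eq
    ... | no  moves with moving-on-path M Bb moves
    ...   | p , p∈ , b∈p = contradiction (on-path⇒followed isF p∈ b∈p Bb) ¬b→

proposition6p1 : (S : List Square) → Bijection (DominoTilings S) (PathFamilies S)
proposition6p1 S = Inverse⇒Bijection (Composition.inverse (tilings≅matchings S) (matchings≅families S))
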